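{- For every positive integer $q$ there exists an integer $N_1(q)$ such that for every $n \ge N_1(q)$, every $n$-optimal $q$-configuration is non-attacking.
   Context: For $n \in \mathbb{N}$ let $I_n = \{\lfloor (2-n)/2 \rfloor, \lfloor (2-n)/2\rfloor + 1, \ldots, \lfloor n/2 \rfloor\}$ (a set of $n$ consecutive integers) and let the board be $\mathcal{B}_n = I_n \times I_n$. A configuration (of Queens) is a finite set $\mathcal{C} \subset \mathbb{Z}\times\mathbb{Z}$; it is a $q$-configuration if $|\mathcal{C}| = q$. For a square $Q=(x,y)$, its attacked set is $A(Q) = \{(x+i,y),(x,y+i),(x+i,y+i),(x+i,y-i) : i \in \mathbb{Z}\setminus\{0\}\}$, and $A(\mathcal{C}) = \bigcup_{Q\in\mathcal{C}} A(Q)$. The cover of $\mathcal{C}$ on $\mathcal{B}_n$ is $\mathrm{cover}_n(\mathcal{C}) = |(\mathcal{C}\cup A(\mathcal{C}))\cap \mathcal{B}_n|$. A $q$-configuration $\mathcal{C}\subset\mathcal{B}_n$ is $n$-optimal if $\mathrm{cover}_n(\mathcal{C}') \le \mathrm{cover}_n(\mathcal{C})$ for every $q$-configuration $\mathcal{C}'\subset \mathcal{B}_n$. A configuration $\mathcal{C}$ is non-attacking if $Q' \notin A(Q)$ for all distinct $Q, Q' \in \mathcal{C}$. -}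

module Defs where

open import Algebra.Bundles using (AbelianGroup)
open import Algebra.Properties.Group using (∙-cancelˡ)
open import Data.Empty using (⊥; ⊥-elim)
open import Data.Integer using (ℤ; +_; 0ℤ; 1ℤ; _+_; _-_; -_; _*_; _/_; _≤_; _<_; +<+)
import Data.Integer as ℤ
import Data.Integer.Properties as ℤₚ
open import Data.Integer.DivMod using (a≡a%n+[a/n]*n; n%d<d)
open import Data.Integer.Tactic.RingSolver using (solve-∀)
open import Data.List using (List; length; filter; map; upTo; cartesianProduct)
open import Data.List.Membership.Propositional using (_∈_)
open import Data.List.Membership.Propositional.Properties using (∈-map⁺; ∈-map⁻; ∈-upTo⁺; ∈-upTo⁻)
open import Data.List.Relation.Binary.Subset.Propositional using (_⊆_)
open import Data.List.Relation.Unary.Any using (Any; any?)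
open import Data.List.Relation.Unary.Unique.Propositional using (Unique)
import Data.List.Relation.Unary.Unique.Propositional.Properties as Uniqueₚ
open import Data.Nat as ℕ using (ℕ)
open import Data.Product using (∃; _×_; _,_)
open import Data.Product.Properties using (≡-dec; ,-injectiveˡ; ,-injectiveʳ)
open import Data.Sum using (_⊎_; inj₁; inj₂)
open import Function using (_⇔_; mk⇔)
open import Relation.Binary.Definitions using (DecidableEquality)
open import Relation.Binary.PropositionalEquality
open import Relation.Nullary using (¬_; Dec; yes; no; ¬?)
open import Relation.Nullary.Decidable using (_×-dec_; _⊎-dec_)
open import Relation.Unary using (Decidable)

Square : Set
Square = ℤ × ℤ

_≟ₛ_ : DecidableEquality Square
_≟ₛ_ = ≡-dec ℤ._≟_ ℤ._≟_

-- Integer division by + 2 rounds towards -∞, so it is ⌊ · / 2 ⌋.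
low high : ℕ → ℤ
low  n = (+ 2 - + n) / + 2
high n = + n / + 2

-- The n consecutive integers low n, …, high n; see ∈-I below.
I : ℕ → List ℤ
I n = map (λ k → low n + + k) (upTo n)

board : ℕ → List Square
board n = cartesianProduct (I n) (I n)

-- Finite subsets of ℤ × ℤ are repetition-free lists, so that the length of the
-- list is the cardinality of the set.
record Configuration : Set where
  constructor config
  field
    squares  : List Square
    distinct : Unique squares

open Configuration public

∣_∣ : Configuration → ℕ
∣ C ∣ = length (squares C)

-- A Q P : the square P belongs to the attacked set of Q.
A : Square → Square → Set
A (x , y) P = ∃ λ i → ¬ (i ≡ 0ℤ) ×
  (P ≡ (x + i , y) ⊎ P ≡ (x , y + i) ⊎ P ≡ (x + i , y + i) ⊎ P ≡ (x + i , y - i))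

private
  shift : ∀ a i → a + i - a ≡ i
  shift = solve-∀

A? : ∀ Q P → Dec (A Q P)
A? (x , y) (x′ , y′) = search (D? (x′ - x)) (D? (y′ - y))
  where
  D : ℤ → Set
  D i = ¬ (i ≡ 0ℤ) ×
    ((x′ , y′) ≡ (x + i , y) ⊎ (x′ , y′) ≡ (x , y + i) ⊎
     (x′ , y′) ≡ (x + i , y + i) ⊎ (x′ , y′) ≡ (x + i , y - i))

  D? : ∀ i → Dec (D i)
  D? i = ¬? (i ℤ.≟ 0ℤ) ×-dec
    ((_ ≟ₛ _) ⊎-dec (_ ≟ₛ _) ⊎-dec (_ ≟ₛ _) ⊎-dec (_ ≟ₛ _))

  displacement : ∀ {a a′} i → a′ ≡ a + i → i ≡ a′ - a
  displacement {a} i refl = sym (shift a i)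

  search : Dec (D (x′ - x)) → Dec (D (y′ - y)) → Dec (∃ D)
  search (yes d) _       = yes (_ , d)
  search (no _)  (yes d) = yes (_ , d)
  search (no ¬h) (no ¬v) = no λ where
    (i , d@(_ , inj₁ e))               → ¬h (subst D (displacement i (,-injectiveˡ e)) d)
    (i , d@(_ , inj₂ (inj₁ e)))        → ¬v (subst D (displacement i (,-injectiveʳ e)) d)
    (i , d@(_ , inj₂ (inj₂ (inj₁ e)))) → ¬h (subst D (displacement i (,-injectiveˡ e)) d)
    (i , d@(_ , inj₂ (inj₂ (inj₂ e)))) → ¬h (subst D (displacement i (,-injectiveˡ e)) d)

-- P ∈ C ∪ A(C)
Covered : Configuration → Square → Set
Covered C P = P ∈ squares C ⊎ Any (λ Q → A Q P) (squares C)

covered? : ∀ C → Decidable (Covered C)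
covered? C P = any? (P ≟ₛ_) (squares C) ⊎-dec any? (λ Q → A? Q P) (squares C)

-- A cardinality, since the board is repetition-free (board-unique).
cover : ℕ → Configuration → ℕ
cover n C = length (filter (covered? C) (board n))

_⊆B_ : Configuration → ℕ → Set
C ⊆B n = squares C ⊆ board n

record Optimal (n q : ℕ) (C : Configuration) : Set where
  field
    size    : ∣ C ∣ ≡ q
    onBoard : C ⊆B n
    maximal : ∀ C′ → ∣ C′ ∣ ≡ q → C′ ⊆B n → cover n C′ ℕ.≤ cover n C

NonAttacking : Configuration → Set
NonAttacking C = ∀ {Q Q′} → Q ∈ squares C → Q′ ∈ squares C → ¬ (Q ≡ Q′) → ¬ A Q Q′

I-unique : ∀ n → Unique (I n)
I-unique n = Uniqueₚ.map⁺ (λ e → ℤₚ.+-injective (∙-cancelˡ ℤ+ (low n) _ _ e)) (Uniqueₚ.upTo⁺ n)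
  where ℤ+ = AbelianGroup.group ℤₚ.+-0-abelianGroup

board-unique : ∀ n → Unique (board n)
board-unique n = Uniqueₚ.cartesianProduct⁺ (I-unique n) (I-unique n)

private
  low+n : ∀ n → low n + + n ≡ 1ℤ + high n
  low+n n = floors (+ n) (low n) (high n) _ _ (n%d<d (+ 2 - + n) (+ 2)) (n%d<d (+ n) (+ 2))
                   (a≡a%n+[a/n]*n (+ 2 - + n) (+ 2)) (a≡a%n+[a/n]*n (+ n) (+ 2))
    where
    module _ (N l h : ℤ) where
      total : ∀ r s → + 2 - N ≡ r + l * + 2 → N ≡ s + h * + 2 → (l + (s + h * + 2)) * + 2 ≡ + 2 - r + (s + h * + 2)
      total r s e f = begin
        (l + (s + h * + 2)) * + 2                 ≡⟨ ring₁ l r (s + h * + 2) ⟩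
        (r + l * + 2) - r + (s + h * + 2) * + 2   ≡⟨ cong (λ t → t - r + (s + h * + 2) * + 2) (sym e) ⟩
        + 2 - N - r + (s + h * + 2) * + 2       ≡⟨ cong (λ t → + 2 - t - r + (s + h * + 2) * + 2) f ⟩
        + 2 - (s + h * + 2) - r + (s + h * + 2) * + 2 ≡⟨ ring₂ r (s + h * + 2) ⟩
        + 2 - r + (s + h * + 2) ∎
        where
        open ≡-Reasoning
        ring₁ : ∀ l r m → (l + m) * + 2 ≡ (r + l * + 2) - r + m * + 2
        ring₁ = solve-∀
        ring₂ : ∀ r m → + 2 - m - r + m * + 2 ≡ + 2 - r + m
        ring₂ = solve-∀

      even≢odd : ∀ a b → a * + 2 ≡ 1ℤ + b * + 2 → ⊥
      even≢odd a b e = odd (a - b) (trans (ring₃ a b) (trans (cong (_- b * + 2) e) (ring₄ b)))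
        where
        ring₃ : ∀ a b → (a - b) * + 2 ≡ a * + 2 - b * + 2
        ring₃ = solve-∀
        ring₄ : ∀ b → 1ℤ + b * + 2 - b * + 2 ≡ 1ℤ
        ring₄ = solve-∀
        odd : ∀ c → c * + 2 ≡ 1ℤ → ⊥
        odd (+ 0) ()
        odd (+ ℕ.suc _) ()
        odd ℤ.-[1+ _ ] ()

      floors : ∀ r s → r ℕ.< 2 → s ℕ.< 2 → + 2 - N ≡ + r + l * + 2 → N ≡ + s + h * + 2 → l + N ≡ 1ℤ + h
      floors 0 0 _ _ e f = trans (cong (λ t → l + t) f) (ℤₚ.*-cancelʳ-≡ (l + (+ 0 + h * + 2)) (1ℤ + h) (+ 2) (trans (total (+ 0) (+ 0) e f) (ring h)))
        where
        ring : ∀ h → + 2 - + 0 + (+ 0 + h * + 2) ≡ (1ℤ + h) * + 2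
        ring = solve-∀
      floors 0 1 _ _ e f = ⊥-elim (even≢odd (l + (+ 1 + h * + 2)) (1ℤ + h) (trans (total (+ 0) (+ 1) e f) (ring h)))
        where
        ring : ∀ h → + 2 - + 0 + (+ 1 + h * + 2) ≡ 1ℤ + (1ℤ + h) * + 2
        ring = solve-∀
      floors 1 0 _ _ e f = ⊥-elim (even≢odd (l + (+ 0 + h * + 2)) h (trans (total (+ 1) (+ 0) e f) (ring h)))
        where
        ring : ∀ h → + 2 - + 1 + (+ 0 + h * + 2) ≡ 1ℤ + h * + 2
        ring = solve-∀
      floors 1 1 _ _ e f = trans (cong (λ t → l + t) f) (ℤₚ.*-cancelʳ-≡ (l + (+ 1 + h * + 2)) (1ℤ + h) (+ 2) (trans (total (+ 1) (+ 1) e f) (ring h)))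
        where
        ring : ∀ h → + 2 - + 1 + (+ 1 + h * + 2) ≡ (1ℤ + h) * + 2
        ring = solve-∀
      floors (ℕ.suc (ℕ.suc _)) _ (ℕ.s≤s (ℕ.s≤s ())) _ _ _
      floors _ (ℕ.suc (ℕ.suc _)) _ (ℕ.s≤s (ℕ.s≤s ())) _ _

∈-I : ∀ n x → x ∈ I n ⇔ (low n ≤ x × x ≤ high n)
∈-I n x = mk⇔ to from
  where
  to : x ∈ I n → low n ≤ x × x ≤ high n
  to p with ∈-map⁻ _ p
  ... | k , k∈ , refl = ℤₚ.i≤i+j (low n) (+ k) ,
    ℤₚ.≤-trans (ℤₚ.i<j⇒i≤pred[j] (subst (low n + + k <_) (low+n n)
                                   (ℤₚ.+-monoʳ-< (low n) (+<+ (∈-upTo⁻ k∈)))))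
               (ℤₚ.≤-reflexive (ℤₚ.pred-suc (high n)))

  from : low n ≤ x × x ≤ high n → x ∈ I n
  from (l≤x , x≤h) = subst (_∈ I n) low+k (∈-map⁺ _ (∈-upTo⁺ k<n))
    where
    k = ℤ.∣ x - low n ∣

    +k : + k ≡ x - low n
    +k = ℤₚ.0≤i⇒+∣i∣≡i (ℤₚ.i≤j⇒0≤j-i l≤x)

    unshift : ∀ a x → a + (x - a) ≡ x
    unshift = solve-∀

    low+k : low n + + k ≡ x
    low+k = trans (cong (λ t → low n + t) +k) (unshift (low n) x)

    k<n : k ℕ.< n
    k<n = ℤₚ.drop‿+<+ (subst₂ _<_ (sym +k) (shift (low n) (+ n))
      (ℤₚ.+-monoˡ-< (- low n) (subst (x <_) (sym (low+n n))
        (ℤₚ.suc[i]≤j⇒i<j (ℤₚ.+-monoʳ-≤ 1ℤ x≤h)))))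

{-# OPTIONS --safe #-}

-- A queen covers the four lines through its square, and a line meets the board
-- in at most n squares.  In an attacking q-configuration two queens share a
-- line, so it covers at most (4q − 1) n squares.  The queens (i , 2i) with
-- i < q lie on 4q distinct lines, each of which meets the board in n − O(q)
-- squares; as two lines meet in at most one square, these queens cover
-- 4qn − O(q²) squares, which is more as soon as n is large.

module Submission where

open import Defs
open import Data.Nat using (ℕ; _≤_; _<_)
open import Data.Product using (∃)
open import Data.Empty using (⊥-elim)
open import Data.Fin using (Fin; zero; suc)
import Data.Fin as Fin
import Data.Fin.Properties as Finₚ
open import Data.Integer using (ℤ; +_; -[1+_]; 0ℤ; 1ℤ; -1ℤ)
import Data.Integer as ℤ
import Data.Integer.Properties as ℤₚ
open import Data.Integer.DivMod using ([n/d]*d≤n; n<s[n/ℕd]*d)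
open import Data.Integer.Tactic.RingSolver using (solve-∀)
open import Data.List
  using (List; []; _∷_; length; filter; map; concatMap; upTo; allFin; cartesianProduct; cartesianProductWith)
open import Data.List.Membership.Propositional using (_∈_; lose; find)
open import Data.List.Membership.Propositional.Properties
open import Data.List.Properties
  using (length-++; length-map; length-upTo; filter-notAll)
open import Data.List.Relation.Binary.Subset.Propositional using (_⊆_)
open import Data.List.Relation.Unary.All using (_∷_)
import Data.List.Relation.Unary.All as All
open import Data.List.Relation.Unary.AllPairs using ([]; _∷_)
open import Data.List.Relation.Unary.Any using (Any; here; there; any?)
import Data.List.Relation.Unary.Any as Any
open import Data.List.Relation.Unary.Unique.Propositional using (Unique)
import Data.List.Relation.Unary.Unique.Propositional.Properties as Uniqueₚ
import Data.Nat as ℕ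
import Data.Nat.Properties as ℕₚ
import Data.Nat.DivMod as ℕDM
open import Data.Nat.Tactic.RingSolver using () renaming (solve-∀ to ℕ-solve-∀)
open import Data.Product using (_×_; _,_; proj₁; proj₂; ∃₂)
open import Data.Product.Properties using (,-injectiveˡ; ,-injectiveʳ)
import Data.Product.Properties as ×ₚ
open import Data.Sum using (_⊎_; inj₁; inj₂; [_,_]′)
open import Function using (_∘_; module Equivalence)
open import Relation.Binary.Definitions using (DecidableEquality)
open import Relation.Binary.PropositionalEquality
open import Relation.Nullary using (¬_; yes; no; ¬?)
open import Relation.Nullary.Decidable using (_×-dec_; _⊎-dec_; from-yes)
open import Relation.Unary using (Decidable)
open import Relation.Unary.Properties using (_∪?_; _∩?_)

-- Counting in lists

module _ {A : Set} (_≟_ : DecidableEquality A) where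

  -- Pigeonhole by induction on `xs`: deleting the head from `ys` shortens `ys` strictly, and the
  -- tail, whose entries differ from the head, is still contained in what remains.
  unique-⊆⇒length-≤ : ∀ {xs ys : List A} → Unique xs → xs ⊆ ys → length xs ≤ length ys
  unique-⊆⇒length-≤ [] _ = ℕ.z≤n
  unique-⊆⇒length-≤ {x ∷ xs} {ys} (x∉xs ∷ u) sub = ℕₚ.≤-trans
    (ℕ.s≤s (unique-⊆⇒length-≤ u λ z∈xs →
      ∈-filter⁺ ≢x? (sub (there z∈xs)) (All.lookup x∉xs z∈xs)))
    (filter-notAll ≢x? ys (Any.map (λ x≡z x≢z → x≢z x≡z) (sub (here refl))))
    where
    ≢x? : Decidable (λ z → ¬ x ≡ z)
    ≢x? z = ¬? (x ≟ z)

length-concatMap-≤ : ∀ {A B : Set} (f : A → List B) xs {m} →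
                     (∀ {x} → x ∈ xs → length (f x) ≤ m) →
                     length (concatMap f xs) ≤ length xs ℕ.* m
length-concatMap-≤ f []       h = ℕ.z≤n
length-concatMap-≤ f (x ∷ xs) h = ℕₚ.≤-trans
  (ℕₚ.≤-reflexive (length-++ (f x)))
  (ℕₚ.+-mono-≤ (h (here refl)) (length-concatMap-≤ f xs (h ∘ there)))

length-cartesianProductWith : ∀ {A B C : Set} (f : A → B → C) xs ys →
  length (cartesianProductWith f xs ys) ≡ length xs ℕ.* length ys
length-cartesianProductWith f []       ys = refl
length-cartesianProductWith f (x ∷ xs) ys = trans
  (length-++ (map (f x) ys))
  (cong₂ ℕ._+_ (length-map (f x) ys) (length-cartesianProductWith f xs ys))

module _ {A : Set} where

  count : {P : A → Set} → Decidable P → List A → ℕ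
  count P? xs = length (filter P? xs)

  -- Inclusion-exclusion for two sets, stated additively to avoid truncated subtraction.
  count-∪∩ : ∀ {P Q : A → Set} (P? : Decidable P) (Q? : Decidable Q) xs →
             count P? xs ℕ.+ count Q? xs ≡ count (P? ∪? Q?) xs ℕ.+ count (P? ∩? Q?) xs
  count-∪∩ P? Q? [] = refl
  count-∪∩ P? Q? (x ∷ xs) with P? x | Q? x | count-∪∩ P? Q? xs
  ... | yes _ | yes _ | ih = cong ℕ.suc (trans (ℕₚ.+-suc _ _) (trans (cong ℕ.suc ih) (sym (ℕₚ.+-suc _ _))))
  ... | yes _ | no  _ | ih = cong ℕ.suc ih
  ... | no  _ | yes _ | ih = trans (ℕₚ.+-suc _ _) (cong ℕ.suc ih)
  ... | no  _ | no  _ | ih = ih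

module _ {A : Set} (_≟_ : DecidableEquality A) {xs : List A} (unique : Unique xs) where

  count-≤ : ∀ {P : A → Set} (P? : Decidable P) {ys} → (∀ {x} → x ∈ xs → P x → x ∈ ys) →
            count P? xs ≤ length ys
  count-≤ P? sub = unique-⊆⇒length-≤ _≟_ (Uniqueₚ.filter⁺ P? unique)
    λ x∈ → let x∈xs , px = ∈-filter⁻ P? {xs = xs} x∈ in sub x∈xs px

  count-mono : ∀ {P Q : A → Set} (P? : Decidable P) (Q? : Decidable Q) →
               (∀ {x} → x ∈ xs → P x → Q x) → count P? xs ≤ count Q? xs
  count-mono P? Q? P⇒Q = count-≤ P? λ x∈xs px → ∈-filter⁺ Q? x∈xs (P⇒Q x∈xs px)

  module _ {I : Set} {R : I → A → Set} (R? : ∀ i → Decidable (R i)) where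

    Union : List I → A → Set
    Union is x = Any (λ i → R i x) is

    union? : ∀ is → Decidable (Union is)
    union? is x = any? (λ i → R? i x) is

    -- The squares satisfying `P` are among the concatenated pieces `P ∩ R i`. Bounding these pieces
    -- rather than the sets `R i` lets the case m = 1 serve the Bonferroni bound below, where only
    -- the intersections are small.
    count-union-≤ : ∀ is {m} {P : A → Set} (P? : Decidable P) →
                    (∀ {x} → x ∈ xs → P x → Union is x) →
                    (∀ {i} → i ∈ is → count (P? ∩? R? i) xs ≤ m) →
                    count P? xs ≤ length is ℕ.* m
    count-union-≤ is P? sub h = ℕₚ.≤-trans
      (count-≤ P? λ x∈xs px → ∈-concatMap⁺ (λ i → filter (P? ∩? R? i) xs)
        (Any.map (λ {i} rx → ∈-filter⁺ (P? ∩? R? i) x∈xs (px , rx)) (sub x∈xs px)))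
      (length-concatMap-≤ _ is h)

    -- Bonferroni: a union of sets meeting pairwise in at most one point has at
    -- least the sum of their cardinalities minus the number of pairs.
    count-union-≥ : (∀ {i j} → ¬ i ≡ j → ∀ {x y} → R i x → R j x → R i y → R j y → x ≡ y) →
                    ∀ {is m} → Unique is → (∀ {i} → i ∈ is → m ≤ count (R? i) xs) →
                    length is ℕ.* m ≤ count (union? is) xs ℕ.+ length is ℕ.* length is
    count-union-≥ meet []  h = ℕ.z≤n
    count-union-≥ meet {i ∷ is} {m} (i∉is ∷ u) h = begin
      m ℕ.+ p ℕ.* m
        ≤⟨ ℕₚ.+-mono-≤ (h (here refl)) (count-union-≥ meet u (h ∘ there)) ⟩
      count (R? i) xs ℕ.+ (count (union? is) xs ℕ.+ p ℕ.* p)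
        ≡⟨ sym (ℕₚ.+-assoc (count (R? i) xs) _ _) ⟩
      count (R? i) xs ℕ.+ count (union? is) xs ℕ.+ p ℕ.* p
        ≡⟨ cong (ℕ._+ p ℕ.* p) (count-∪∩ (R? i) (union? is) xs) ⟩
      count (R? i ∪? union? is) xs ℕ.+ count (R? i ∩? union? is) xs ℕ.+ p ℕ.* p
        ≤⟨ ℕₚ.+-monoˡ-≤ (p ℕ.* p) (ℕₚ.+-mono-≤ ∪-≤ ∩-≤) ⟩
      count (union? (i ∷ is)) xs ℕ.+ p ℕ.+ p ℕ.* p
        ≡⟨ ℕₚ.+-assoc (count (union? (i ∷ is)) xs) _ _ ⟩
      count (union? (i ∷ is)) xs ℕ.+ ℕ.suc p ℕ.* p
        ≤⟨ ℕₚ.+-monoʳ-≤ (count (union? (i ∷ is)) xs) (ℕₚ.*-monoʳ-≤ (ℕ.suc p) (ℕₚ.n≤1+n p)) ⟩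
      count (union? (i ∷ is)) xs ℕ.+ ℕ.suc p ℕ.* ℕ.suc p ∎
      where
      open ℕₚ.≤-Reasoning
      p = length is

      ∪-≤ : count (R? i ∪? union? is) xs ≤ count (union? (i ∷ is)) xs
      ∪-≤ = count-mono (R? i ∪? union? is) (union? (i ∷ is)) λ _ → [ here , there ]′

      subsingleton : ∀ {zs : List A} → Unique zs → (∀ {x y} → x ∈ zs → y ∈ zs → x ≡ y) → length zs ≤ 1
      subsingleton []       _  = ℕ.z≤n
      subsingleton (_ ∷ []) _  = ℕ.s≤s ℕ.z≤n
      subsingleton ((x≢y ∷ _) ∷ (_ ∷ _)) eq = ⊥-elim (x≢y (eq (here refl) (there (here refl))))

      -- The set of index i meets each of the p other sets in at most one point, hence their union
      -- in at most p points.
      ∩-≤ : count (R? i ∩? union? is) xs ≤ p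
      ∩-≤ = ℕₚ.≤-trans
        (count-union-≤ is {1} both? (λ _ → proj₂) λ {j} j∈is →
          subsingleton (Uniqueₚ.filter⁺ (both? ∩? R? j) unique) λ x∈ y∈ →
            let (rx , _) , rx′ = proj₂ (∈-filter⁻ (both? ∩? R? j) {xs = xs} x∈)
                (ry , _) , ry′ = proj₂ (∈-filter⁻ (both? ∩? R? j) {xs = xs} y∈)
            in meet (All.lookup i∉is j∈is) rx rx′ ry ry′)
        (ℕₚ.≤-reflexive (ℕₚ.*-identityʳ p))
        where both? = R? i ∩? union? is

-- Lines

Direction : Set
Direction = Fin 4

pattern horizontal   = zero
pattern vertical     = suc zero
pattern diagonal     = suc (suc zero)
pattern antidiagonal = suc (suc (suc zero))

step : Direction → ℤ × ℤ
step horizontal   = 1ℤ , 0ℤ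
step vertical     = 0ℤ , 1ℤ
step diagonal     = 1ℤ , 1ℤ
step antidiagonal = 1ℤ , -1ℤ

-- The linear form that is constant exactly on the lines of direction d.
form : Direction → Square → ℤ
form d (x , y) = proj₂ (step d) ℤ.* x ℤ.- proj₁ (step d) ℤ.* y

move : Direction → Square → ℤ → Square
move d (x , y) t = x ℤ.+ t ℤ.* proj₁ (step d) , y ℤ.+ t ℤ.* proj₂ (step d)

form-move : ∀ d Q t → form d (move d Q t) ≡ form d Q
form-move d (x , y) t = ring (proj₁ (step d)) (proj₂ (step d)) x y t
  where
  ring : ∀ a b x y t → b ℤ.* (x ℤ.+ t ℤ.* a) ℤ.- a ℤ.* (y ℤ.+ t ℤ.* b) ≡ b ℤ.* x ℤ.- a ℤ.* y
  ring = solve-∀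

-- Every step has a coordinate equal to 1, and that coordinate recovers the parameter.
move-injective : ∀ d Q {s t} → move d Q s ≡ move d Q t → s ≡ t
move-injective d (x , y) {s} {t} e = go d e
  where
  cancel : ∀ x → x ℤ.+ s ℤ.* 1ℤ ≡ x ℤ.+ t ℤ.* 1ℤ → s ≡ t
  cancel x e = trans (ring₁ x s) (trans (cong (ℤ._- x) e) (sym (ring₁ x t)))
    where
    ring₁ : ∀ x s → s ≡ x ℤ.+ s ℤ.* 1ℤ ℤ.- x
    ring₁ = solve-∀
  go : ∀ d → move d (x , y) s ≡ move d (x , y) t → s ≡ t
  go horizontal   e = cancel x (,-injectiveˡ e)
  go vertical     e = cancel y (,-injectiveʳ e)
  go diagonal     e = cancel x (,-injectiveˡ e)
  go antidiagonal e = cancel x (,-injectiveˡ e)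

-- The four alternatives in `A` are the four directions, in the same order.
A⇒form-≡ : ∀ {Q P} → A Q P → ∃ λ d → form d P ≡ form d Q
A⇒form-≡ {x , y} (i , _ , inj₁ refl) = horizontal , ring x y i
  where
  ring : ∀ x y i → 0ℤ ℤ.* (x ℤ.+ i) ℤ.- 1ℤ ℤ.* y ≡ 0ℤ ℤ.* x ℤ.- 1ℤ ℤ.* y
  ring = solve-∀
A⇒form-≡ {x , y} (i , _ , inj₂ (inj₁ refl)) = vertical , ring x y i
  where
  ring : ∀ x y i → 1ℤ ℤ.* x ℤ.- 0ℤ ℤ.* (y ℤ.+ i) ≡ 1ℤ ℤ.* x ℤ.- 0ℤ ℤ.* y
  ring = solve-∀
A⇒form-≡ {x , y} (i , _ , inj₂ (inj₂ (inj₁ refl))) = diagonal , ring x y i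
  where
  ring : ∀ x y i → 1ℤ ℤ.* (x ℤ.+ i) ℤ.- 1ℤ ℤ.* (y ℤ.+ i) ≡ 1ℤ ℤ.* x ℤ.- 1ℤ ℤ.* y
  ring = solve-∀
A⇒form-≡ {x , y} (i , _ , inj₂ (inj₂ (inj₂ refl))) = antidiagonal , ring x y i
  where
  ring : ∀ x y i → -1ℤ ℤ.* (x ℤ.+ i) ℤ.- 1ℤ ℤ.* (y ℤ.- i) ≡ -1ℤ ℤ.* x ℤ.- 1ℤ ℤ.* y
  ring = solve-∀

-- The parameter is the difference in a coordinate where the step is 1; the equation of the line
-- then determines the other coordinate.
form-≡⇒move : ∀ d {Q P} → form d P ≡ form d Q → ∃ λ t → P ≡ move d Q t
form-≡⇒move horizontal {x , y} {x′ , y′} e =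
  x′ ℤ.- x , cong₂ _,_ (ring₁ x x′) (trans (ring₂ x′ y′) (trans (cong ℤ.-_ e) (ring₃ x y x′)))
  where
  ring₁ : ∀ x x′ → x′ ≡ x ℤ.+ (x′ ℤ.- x) ℤ.* 1ℤ
  ring₁ = solve-∀
  ring₂ : ∀ x y → y ≡ ℤ.- (0ℤ ℤ.* x ℤ.- 1ℤ ℤ.* y)
  ring₂ = solve-∀
  ring₃ : ∀ x y x′ → ℤ.- (0ℤ ℤ.* x ℤ.- 1ℤ ℤ.* y) ≡ y ℤ.+ (x′ ℤ.- x) ℤ.* 0ℤ
  ring₃ = solve-∀
form-≡⇒move vertical {x , y} {x′ , y′} e =
  y′ ℤ.- y , cong₂ _,_ (trans (ring₂ x′ y′) (trans e (ring₃ x y y′))) (ring₁ y y′)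
  where
  ring₁ : ∀ y y′ → y′ ≡ y ℤ.+ (y′ ℤ.- y) ℤ.* 1ℤ
  ring₁ = solve-∀
  ring₂ : ∀ x y → x ≡ 1ℤ ℤ.* x ℤ.- 0ℤ ℤ.* y
  ring₂ = solve-∀
  ring₃ : ∀ x y y′ → 1ℤ ℤ.* x ℤ.- 0ℤ ℤ.* y ≡ x ℤ.+ (y′ ℤ.- y) ℤ.* 0ℤ
  ring₃ = solve-∀
form-≡⇒move diagonal {x , y} {x′ , y′} e =
  x′ ℤ.- x , cong₂ _,_ (ring₁ x x′) (trans (ring₂ x′ y′) (trans (cong (λ c → x′ ℤ.- c) e) (ring₃ x y x′)))
  where
  ring₁ : ∀ x x′ → x′ ≡ x ℤ.+ (x′ ℤ.- x) ℤ.* 1ℤ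
  ring₁ = solve-∀
  ring₂ : ∀ x y → y ≡ x ℤ.- (1ℤ ℤ.* x ℤ.- 1ℤ ℤ.* y)
  ring₂ = solve-∀
  ring₃ : ∀ x y x′ → x′ ℤ.- (1ℤ ℤ.* x ℤ.- 1ℤ ℤ.* y) ≡ y ℤ.+ (x′ ℤ.- x) ℤ.* 1ℤ
  ring₃ = solve-∀
form-≡⇒move antidiagonal {x , y} {x′ , y′} e =
  x′ ℤ.- x , cong₂ _,_ (ring₁ x x′) (trans (ring₂ x′ y′) (trans (cong (λ c → ℤ.- x′ ℤ.- c) e) (ring₃ x y x′)))
  where
  ring₁ : ∀ x x′ → x′ ≡ x ℤ.+ (x′ ℤ.- x) ℤ.* 1ℤ
  ring₁ = solve-∀
  ring₂ : ∀ x y → y ≡ ℤ.- x ℤ.- (-1ℤ ℤ.* x ℤ.- 1ℤ ℤ.* y)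
  ring₂ = solve-∀
  ring₃ : ∀ x y x′ → ℤ.- x′ ℤ.- (-1ℤ ℤ.* x ℤ.- 1ℤ ℤ.* y) ≡ y ℤ.+ (x′ ℤ.- x) ℤ.* -1ℤ
  ring₃ = solve-∀

A-move : ∀ d Q {t} → ¬ t ≡ 0ℤ → A Q (move d Q t)
A-move d (x , y) {t} t≢0 = t , t≢0 , go d
  where
  ×1 : ∀ x t → x ℤ.+ t ℤ.* 1ℤ ≡ x ℤ.+ t
  ×1 = solve-∀
  ×0 : ∀ x t → x ℤ.+ t ℤ.* 0ℤ ≡ x
  ×0 = solve-∀
  ×-1 : ∀ x t → x ℤ.+ t ℤ.* -1ℤ ≡ x ℤ.- t
  ×-1 = solve-∀
  go : ∀ d → let P = move d (x , y) t in
       P ≡ (x ℤ.+ t , y) ⊎ P ≡ (x , y ℤ.+ t) ⊎ P ≡ (x ℤ.+ t , y ℤ.+ t) ⊎ P ≡ (x ℤ.+ t , y ℤ.- t)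
  go horizontal   = inj₁ (cong₂ _,_ (×1 x t) (×0 y t))
  go vertical     = inj₂ (inj₁ (cong₂ _,_ (×0 x t) (×1 y t)))
  go diagonal     = inj₂ (inj₂ (inj₁ (cong₂ _,_ (×1 x t) (×1 y t))))
  go antidiagonal = inj₂ (inj₂ (inj₂ (cong₂ _,_ (×1 x t) (×-1 y t))))

move-0 : ∀ d Q → move d Q 0ℤ ≡ Q
move-0 d (x , y) = cong₂ _,_ (ring x (proj₁ (step d))) (ring y (proj₂ (step d)))
  where
  ring : ∀ x a → x ℤ.+ 0ℤ ℤ.* a ≡ x
  ring = solve-∀

-- A line is encoded by its direction and the value of `form` along it, so that distinct lines are
-- simply distinct pairs and incidence is decidable.
Line : Set
Line = Direction × ℤ

lineThrough : Direction → Square → Line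
lineThrough d Q = d , form d Q

On : Line → Square → Set
On (d , c) P = form d P ≡ c

on? : ∀ l → Decidable (On l)
on? (d , c) P = form d P ℤ.≟ c

covered⇒on : ∀ C {P} → Covered C P → ∃₂ λ d Q → Q ∈ squares C × On (lineThrough d Q) P
-- A queen lies on all four of its own lines; the horizontal one is an arbitrary choice.
covered⇒on C {P} (inj₁ P∈C) = horizontal , P , P∈C , refl
covered⇒on C     (inj₂ att) with find att
... | Q , Q∈C , a with A⇒form-≡ a
... | d , e = d , Q , Q∈C , e

-- The parameter 0 gives the square of the queen itself, every other parameter an attacked square.
on⇒covered : ∀ C {P} d {Q} → Q ∈ squares C → On (lineThrough d Q) P → Covered C P
on⇒covered C d {Q} Q∈C on with form-≡⇒move d {Q} on
... | t , refl with t ℤ.≟ 0ℤ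
... | yes refl = inj₁ (subst (_∈ squares C) (sym (move-0 d Q)) Q∈C)
... | no  t≢0  = inj₂ (lose Q∈C (A-move d Q t≢0))

-- The determinant of the two step vectors.
det : Direction → Direction → ℤ
det d e = proj₁ (step d) ℤ.* proj₂ (step e) ℤ.- proj₁ (step e) ℤ.* proj₂ (step d)

det-nonZero : ∀ d e → d ≡ e ⊎ ¬ det d e ≡ 0ℤ
det-nonZero = from-yes (Finₚ.all? λ d → Finₚ.all? λ e → (d Fin.≟ e) ⊎-dec ¬? (det d e ℤ.≟ 0ℤ))

-- Distinct lines through a common square have different directions. Cramer's rule then recovers
-- both coordinates from the two forms, up to the nonzero determinant.
lines-meet-once : ∀ {k l} → ¬ k ≡ l → ∀ {P Q} → On k P → On l P → On k Q → On l Q → P ≡ Q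
lines-meet-once {d , _} {e , _} k≢l {x , y} {x′ , y′} refl refl kQ lQ with det-nonZero d e
... | inj₁ refl = ⊥-elim (k≢l refl)
... | inj₂ det≢0 = cong₂ _,_
  (cancel (trans (cramer₁ a b a′ b′ x y)
    (trans (cong₂ (λ u v → a ℤ.* u ℤ.- a′ ℤ.* v) (sym lQ) (sym kQ)) (sym (cramer₁ a b a′ b′ x′ y′)))))
  (cancel (trans (cramer₂ a b a′ b′ x y)
    (trans (cong₂ (λ u v → b ℤ.* u ℤ.- b′ ℤ.* v) (sym lQ) (sym kQ)) (sym (cramer₂ a b a′ b′ x′ y′)))))
  where
  a = proj₁ (step d)
  b = proj₂ (step d)
  a′ = proj₁ (step e)
  b′ = proj₂ (step e)
  cancel : ∀ {u v} → det d e ℤ.* u ≡ det d e ℤ.* v → u ≡ v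
  cancel = ℤₚ.*-cancelˡ-≡ (det d e) _ _ ⦃ ℤ.≢-nonZero det≢0 ⦄
  cramer₁ : ∀ a b a′ b′ x y → (a ℤ.* b′ ℤ.- a′ ℤ.* b) ℤ.* x ≡
            a ℤ.* (b′ ℤ.* x ℤ.- a′ ℤ.* y) ℤ.- a′ ℤ.* (b ℤ.* x ℤ.- a ℤ.* y)
  cramer₁ = solve-∀
  cramer₂ : ∀ a b a′ b′ x y → (a ℤ.* b′ ℤ.- a′ ℤ.* b) ℤ.* y ≡
            b ℤ.* (b′ ℤ.* x ℤ.- a′ ℤ.* y) ℤ.- b′ ℤ.* (b ℤ.* x ℤ.- a ℤ.* y)
  cramer₂ = solve-∀

-- Lines on the board

length-I : ∀ n → length (I n) ≡ n
length-I n = trans (length-map _ (upTo n)) (length-upTo n)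

-- On a given line one coordinate determines the square, so the board squares of the line lie in an
-- image of `I n`.
line-≤ : ∀ n l → count (on? l) (board n) ≤ n
line-≤ n (d , c) = ℕₚ.≤-trans
  (count-≤ _≟ₛ_ (board-unique n) (on? (d , c)) λ P∈B on → on-image d (∈-cartesianProduct⁻ (I n) (I n) P∈B) on)
  (ℕₚ.≤-reflexive (trans (length-map (point d) (I n)) (length-I n)))
  where
  point : Direction → ℤ → Square
  -- The horizontal form is -y, hence the sign.
  point horizontal   x = x , ℤ.- c
  point vertical     y = c , y
  point diagonal     x = x , x ℤ.- c
  point antidiagonal x = x , ℤ.- x ℤ.- c

  on-image : ∀ d {P} → proj₁ P ∈ I n × proj₂ P ∈ I n → On (d , c) P → P ∈ map (point d) (I n)
  on-image horizontal {x , y} (x∈I , _) refl =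
    subst (_∈ map (point horizontal) (I n)) (cong (x ,_) (ring x y)) (∈-map⁺ (point horizontal) x∈I)
    where
    ring : ∀ x y → ℤ.- (0ℤ ℤ.* x ℤ.- 1ℤ ℤ.* y) ≡ y
    ring = solve-∀
  on-image vertical {x , y} (_ , y∈I) refl =
    subst (_∈ map (point vertical) (I n)) (cong (_, y) (ring x y)) (∈-map⁺ (point vertical) y∈I)
    where
    ring : ∀ x y → 1ℤ ℤ.* x ℤ.- 0ℤ ℤ.* y ≡ x
    ring = solve-∀
  on-image diagonal {x , y} (x∈I , _) refl =
    subst (_∈ map (point diagonal) (I n)) (cong (x ,_) (ring x y)) (∈-map⁺ (point diagonal) x∈I)
    where
    ring : ∀ x y → x ℤ.- (1ℤ ℤ.* x ℤ.- 1ℤ ℤ.* y) ≡ y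
    ring = solve-∀
  on-image antidiagonal {x , y} (x∈I , _) refl =
    subst (_∈ map (point antidiagonal) (I n)) (cong (x ,_) (ring x y)) (∈-map⁺ (point antidiagonal) x∈I)
    where
    ring : ∀ x y → ℤ.- x ℤ.- (-1ℤ ℤ.* x ℤ.- 1ℤ ℤ.* y) ≡ y
    ring = solve-∀

-- The summand 2 comes from the lower end: 2 - n ≤ -2r gives ⌊(2 - n)/2⌋ ≤ -r. The upper end follows
-- from 2r ≤ n.
∣i∣≤r⇒i∈I : ∀ {n r} → 2 ℕ.+ r ℕ.* 2 ≤ n → ∀ i → ℤ.∣ i ∣ ≤ r → i ∈ I n
∣i∣≤r⇒i∈I {n} {r} h i ∣i∣≤r = Equivalence.from (∈-I n i) (bounds i ∣i∣≤r)
  where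
  low≤-r : low n ℤ.≤ ℤ.- + r
  low≤-r = ℤₚ.*-cancelʳ-≤-pos (low n) (ℤ.- + r) (+ 2) (begin
    low n ℤ.* + 2                     ≤⟨ [n/d]*d≤n (+ 2 ℤ.- + n) (+ 2) ⟩
    + 2 ℤ.- + n                       ≤⟨ ℤₚ.+-monoʳ-≤ (+ 2) (ℤₚ.neg-mono-≤ (ℤ.+≤+ h)) ⟩
    + 2 ℤ.- + (2 ℕ.+ r ℕ.* 2)         ≡⟨ cong (λ z → + 2 ℤ.- (+ 2 ℤ.+ z)) (ℤₚ.pos-* r 2) ⟩
    + 2 ℤ.- (+ 2 ℤ.+ + r ℤ.* + 2)     ≡⟨ ring (+ r) ⟩
    ℤ.- + r ℤ.* + 2                   ∎)
    where
    open ℤₚ.≤-Reasoning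
    ring : ∀ r → + 2 ℤ.- (+ 2 ℤ.+ r ℤ.* + 2) ≡ ℤ.- r ℤ.* + 2
    ring = solve-∀

  r≤high : + r ℤ.≤ high n
  r≤high = ℤₚ.≤-trans (ℤₚ.i<j⇒i≤pred[j] (ℤₚ.*-cancelʳ-<-nonNeg {+ r} {ℤ.suc (high n)} (+ 2) (begin-strict
    + r ℤ.* + 2              ≡⟨ sym (ℤₚ.pos-* r 2) ⟩
    + (r ℕ.* 2)              ≤⟨ ℤ.+≤+ (ℕₚ.≤-trans (ℕₚ.m≤n+m (r ℕ.* 2) 2) h) ⟩
    + n                      <⟨ n<s[n/ℕd]*d (+ n) 2 ⟩
    -- Division by `+ 2` unfolds to the sign `1ℤ` times `/ℕ`; this factor is inserted here.
    ℤ.suc (+ n ℤ./ℕ 2) ℤ.* + 2  ≡⟨ cong (λ z → ℤ.suc z ℤ.* + 2) (sym (ℤₚ.*-identityˡ (+ n ℤ./ℕ 2))) ⟩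
    ℤ.suc (high n) ℤ.* + 2   ∎)))
    (ℤₚ.≤-reflexive (ℤₚ.pred-suc (high n)))
    where open ℤₚ.≤-Reasoning

  bounds : ∀ i → ℤ.∣ i ∣ ≤ r → low n ℤ.≤ i × i ℤ.≤ high n
  bounds (+ k)    k≤r = ℤₚ.≤-trans low≤-r (ℤₚ.≤-trans (ℤₚ.neg-mono-≤ (ℤ.+≤+ ℕ.z≤n)) (ℤ.+≤+ ℕ.z≤n)) ,
                        ℤₚ.≤-trans (ℤ.+≤+ k≤r) r≤high
  bounds -[1+ k ] k<r = ℤₚ.≤-trans low≤-r (ℤₚ.neg-mono-≤ (ℤ.+≤+ k<r)) ,
                        ℤₚ.≤-trans ℤ.-≤+ r≤high

∣step∣≤1 : ∀ d → ℤ.∣ proj₁ (step d) ∣ ≤ 1 × ℤ.∣ proj₂ (step d) ∣ ≤ 1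
∣step∣≤1 = from-yes (Finₚ.all? λ d → (ℤ.∣ proj₁ (step d) ∣ ℕ.≤? 1) ×-dec (ℤ.∣ proj₂ (step d) ∣ ℕ.≤? 1))

∣k-m∣≤m : ∀ {k} m → k < ℕ.suc (m ℕ.* 2) → ℤ.∣ + k ℤ.- + m ∣ ≤ m
∣k-m∣≤m {k} m (ℕ.s≤s k≤2m) rewrite ℤₚ.m-n≡m⊖n k m with ℕₚ.≤-total m k
... | inj₁ m≤k rewrite ℤₚ.⊖-≥ m≤k =
  ℕₚ.m≤n+o⇒m∸n≤o k m (ℕₚ.≤-trans k≤2m (ℕₚ.≤-reflexive (twice m)))
  where
  twice : ∀ m → m ℕ.* 2 ≡ m ℕ.+ m
  twice = ℕ-solve-∀
... | inj₂ k≤m = ℕₚ.≤-trans (ℕₚ.≤-reflexive (ℤₚ.∣⊖∣-≤ k≤m)) (ℕₚ.m∸n≤m m k)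

-- The 2m + 1 squares at most m steps from the base square have coordinates of absolute value at
-- most s + m, because those of a step are at most 1. They therefore stay on the board.
line-≥ : ∀ {n} m s → 2 ℕ.+ (s ℕ.+ m) ℕ.* 2 ≤ n → ∀ d {x y} → ℤ.∣ x ∣ ≤ s → ℤ.∣ y ∣ ≤ s →
         ℕ.suc (m ℕ.* 2) ≤ count (on? (lineThrough d (x , y))) (board n)
line-≥ {n} m s h d {x} {y} ∣x∣≤s ∣y∣≤s = ℕₚ.≤-trans
  (ℕₚ.≤-reflexive (sym (trans (length-map point (upTo (ℕ.suc (m ℕ.* 2)))) (length-upTo (ℕ.suc (m ℕ.* 2))))))
  (unique-⊆⇒length-≤ _≟ₛ_ (Uniqueₚ.map⁺ point-injective (Uniqueₚ.upTo⁺ _)) points⊆)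
  where
  point : ℕ → Square
  -- Subtracting m turns the range 0, ..., 2m into -m, ..., m.
  point k = move d (x , y) (+ k ℤ.- + m)

  point-injective : ∀ {j k} → point j ≡ point k → j ≡ k
  point-injective {j} {k} e = ℤₚ.+-injective
    (trans (ring (+ j) (+ m)) (trans (cong (ℤ._+ + m) (move-injective d (x , y) {+ j ℤ.- + m} {+ k ℤ.- + m} e)) (sym (ring (+ k) (+ m)))))
    where
    ring : ∀ j m → j ≡ j ℤ.- m ℤ.+ m
    ring = solve-∀

  near : ∀ u t a → ℤ.∣ u ∣ ≤ s → ℤ.∣ t ∣ ≤ m → ℤ.∣ a ∣ ≤ 1 → u ℤ.+ t ℤ.* a ∈ I n
  near u t a ∣u∣≤s ∣t∣≤m ∣a∣≤1 = ∣i∣≤r⇒i∈I h (u ℤ.+ t ℤ.* a) (begin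
    ℤ.∣ u ℤ.+ t ℤ.* a ∣             ≤⟨ ℤₚ.∣i+j∣≤∣i∣+∣j∣ u (t ℤ.* a) ⟩
    ℤ.∣ u ∣ ℕ.+ ℤ.∣ t ℤ.* a ∣       ≡⟨ cong (ℤ.∣ u ∣ ℕ.+_) (ℤₚ.abs-* t a) ⟩
    ℤ.∣ u ∣ ℕ.+ ℤ.∣ t ∣ ℕ.* ℤ.∣ a ∣ ≤⟨ ℕₚ.+-mono-≤ ∣u∣≤s (ℕₚ.*-mono-≤ ∣t∣≤m ∣a∣≤1) ⟩
    s ℕ.+ m ℕ.* 1                   ≡⟨ cong (s ℕ.+_) (ℕₚ.*-identityʳ m) ⟩
    s ℕ.+ m                         ∎)
    where open ℕₚ.≤-Reasoning

  points⊆ : map point (upTo (ℕ.suc (m ℕ.* 2))) ⊆ filter (on? (lineThrough d (x , y))) (board n)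
  points⊆ p∈ with ∈-map⁻ point p∈
  ... | k , k∈ , refl = ∈-filter⁺ (on? (lineThrough d (x , y)))
    (∈-cartesianProduct⁺ (near x (+ k ℤ.- + m) (proj₁ (step d)) ∣x∣≤s (∣k-m∣≤m m (∈-upTo⁻ k∈)) (proj₁ (∣step∣≤1 d)))
                         (near y (+ k ℤ.- + m) (proj₂ (step d)) ∣y∣≤s (∣k-m∣≤m m (∈-upTo⁻ k∈)) (proj₂ (∣step∣≤1 d))))
    (form-move d (x , y) (+ k ℤ.- + m))

-- The two bounds on the cover

-- The 4|C| pairs of a direction and a queen name all lines of the configuration. Two of these pairs
-- name the same line, so at most 4|C| - 1 lines, each with at most n board squares, cover
-- everything that `C` covers.
cover-attacking : ∀ n C {Q Q′} → Q ∈ squares C → Q′ ∈ squares C → ¬ Q ≡ Q′ → A Q Q′ →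
                  cover n C ℕ.+ n ≤ 4 ℕ.* ∣ C ∣ ℕ.* n
cover-attacking n C {Q} {Q′} Q∈C Q′∈C Q≢Q′ a with A⇒form-≡ a
... | d , e = begin
  cover n C ℕ.+ n             ≤⟨ ℕₚ.+-monoˡ-≤ n cover≤ ⟩
  length lines ℕ.* n ℕ.+ n    ≡⟨ ℕₚ.+-comm (length lines ℕ.* n) n ⟩
  ℕ.suc (length lines) ℕ.* n  ≤⟨ ℕₚ.*-monoˡ-≤ n fewer ⟩
  length incidences ℕ.* n     ≡⟨ cong (ℕ._* n) (length-cartesianProductWith _,_ (allFin 4) (squares C)) ⟩
  4 ℕ.* ∣ C ∣ ℕ.* n           ∎
  where
  open ℕₚ.≤-Reasoning

  incidences : List (Direction × Square)
  incidences = cartesianProduct (allFin 4) (squares C)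

  ≢dQ? : Decidable (λ i → ¬ i ≡ (d , Q))
  ≢dQ? i = ¬? (×ₚ.≡-dec Fin._≟_ _≟ₛ_ i (d , Q))

  -- (d , Q) is dropped, since (d , Q′) has the same line.
  others : List (Direction × Square)
  others = filter ≢dQ? incidences

  toLine : Direction × Square → Line
  toLine (e , R) = lineThrough e R

  lines : List Line
  lines = map toLine others

  ∈-incidences : ∀ e {R} → R ∈ squares C → (e , R) ∈ incidences
  ∈-incidences e = ∈-cartesianProduct⁺ (∈-allFin e)

  fewer : length lines < length incidences
  fewer = subst (_< length incidences) (sym (length-map toLine others))
    (filter-notAll ≢dQ? incidences (lose (∈-incidences d Q∈C) (λ ≢ → ≢ refl)))

  onSome : ∀ {P} → Covered C P → Union _≟ₛ_ (board-unique n) on? lines P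
  onSome {P} cov with covered⇒on C cov
  ... | e′ , R , R∈C , on with ×ₚ.≡-dec Fin._≟_ _≟ₛ_ (e′ , R) (d , Q)
  ... | no ≢dQ   = lose (∈-map⁺ toLine (∈-filter⁺ ≢dQ? (∈-incidences e′ R∈C) ≢dQ)) on
  ... | yes refl = lose
    (∈-map⁺ toLine (∈-filter⁺ ≢dQ? (∈-incidences d Q′∈C) (λ eq → Q≢Q′ (sym (,-injectiveʳ eq)))))
    (trans on (sym e))

  cover≤ : cover n C ≤ length lines ℕ.* n
  cover≤ = count-union-≤ _≟ₛ_ (board-unique n) on? lines (covered? C) (λ _ → onSome)
    λ {l} _ → ℕₚ.≤-trans
      (count-mono _≟ₛ_ (board-unique n) (covered? C ∩? on? l) (on? l) (λ _ → proj₂))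
      (line-≤ n l)

-- The comparison configuration

slope2 : ℕ → Square
slope2 i = + i , + (i ℕ.* 2)

slope2-injective : ∀ {i j} → slope2 i ≡ slope2 j → i ≡ j
slope2-injective e = ℤₚ.+-injective (,-injectiveˡ e)

-- No direction has slope 2. Hence in each direction the form at `slope2 i` is a nonzero constant
-- times i, and different queens get different parallel lines.
slope2-line-injective : ∀ {d e i j} → lineThrough d (slope2 i) ≡ lineThrough e (slope2 j) → d ≡ e × i ≡ j
slope2-line-injective {d} {e} {i} {j} eq with ,-injectiveˡ eq
... | refl = refl , ℤₚ.+-injective (ℤₚ.*-cancelˡ-≡ (slope d) (+ i) (+ j) ⦃ ℤ.≢-nonZero (slope≢0 d) ⦄
    (trans (sym (factor i)) (trans (,-injectiveʳ eq) (factor j))))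
  where
  slope : Direction → ℤ
  slope d = proj₂ (step d) ℤ.- proj₁ (step d) ℤ.* + 2
  slope≢0 : ∀ d → ¬ slope d ≡ 0ℤ
  slope≢0 = from-yes (Finₚ.all? λ d → ¬? (slope d ℤ.≟ 0ℤ))
  factor : ∀ i → form d (slope2 i) ≡ slope d ℤ.* + i
  factor i = trans (cong (λ y → proj₂ (step d) ℤ.* + i ℤ.- proj₁ (step d) ℤ.* y) (ℤₚ.pos-* i 2))
                   (ring (proj₁ (step d)) (proj₂ (step d)) (+ i))
    where
    ring : ∀ a b i → b ℤ.* i ℤ.- a ℤ.* (i ℤ.* + 2) ≡ (b ℤ.- a ℤ.* + 2) ℤ.* i
    ring = solve-∀

queens : ℕ → Configuration
queens q = config (map slope2 (upTo q)) (Uniqueₚ.map⁺ slope2-injective (Uniqueₚ.upTo⁺ q))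

queens-size : ∀ q → ∣ queens q ∣ ≡ q
queens-size q = trans (length-map slope2 (upTo q)) (length-upTo q)

∣slope2∣≤ : ∀ {q i} → i < q → ℤ.∣ proj₁ (slope2 i) ∣ ≤ q ℕ.* 2 × ℤ.∣ proj₂ (slope2 i) ∣ ≤ q ℕ.* 2
∣slope2∣≤ {q} {i} i<q = ℕₚ.≤-trans (ℕₚ.m≤m*n i 2) i*2≤q*2 , i*2≤q*2
  where
  i*2≤q*2 : i ℕ.* 2 ≤ q ℕ.* 2
  i*2≤q*2 = ℕₚ.*-monoˡ-≤ 2 (ℕₚ.<⇒≤ i<q)

queens-onBoard : ∀ {n} q → 2 ℕ.+ q ℕ.* 2 ℕ.* 2 ≤ n → queens q ⊆B n
queens-onBoard q h Q∈ with ∈-map⁻ slope2 Q∈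
... | i , i∈ , refl = ∈-cartesianProduct⁺
  (∣i∣≤r⇒i∈I h _ (proj₁ (∣slope2∣≤ (∈-upTo⁻ i∈)))) (∣i∣≤r⇒i∈I h _ (proj₂ (∣slope2∣≤ (∈-upTo⁻ i∈))))

-- The Bonferroni bound for 4q distinct lines. The queens have coordinates at most 2q, so each line
-- has at least 2m + 1 board squares.
cover-queens : ∀ {n} q m → 2 ℕ.+ (q ℕ.* 2 ℕ.+ m) ℕ.* 2 ≤ n →
               4 ℕ.* q ℕ.* ℕ.suc (m ℕ.* 2) ≤ cover n (queens q) ℕ.+ 4 ℕ.* q ℕ.* (4 ℕ.* q)
cover-queens {n} q m h = begin
  4 ℕ.* q ℕ.* ℕ.suc (m ℕ.* 2)
    ≡⟨ cong (ℕ._* ℕ.suc (m ℕ.* 2)) (sym length-lines) ⟩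
  length lines ℕ.* ℕ.suc (m ℕ.* 2)
    ≤⟨ count-union-≥ _≟ₛ_ (board-unique n) on? lines-meet-once lines-unique long ⟩
  count union (board n) ℕ.+ length lines ℕ.* length lines
    ≤⟨ ℕₚ.+-monoˡ-≤ _ (count-mono _≟ₛ_ (board-unique n) union (covered? (queens q)) λ _ → on-covered) ⟩
  cover n (queens q) ℕ.+ length lines ℕ.* length lines
    ≡⟨ cong (λ p → cover n (queens q) ℕ.+ p ℕ.* p) length-lines ⟩
  cover n (queens q) ℕ.+ 4 ℕ.* q ℕ.* (4 ℕ.* q) ∎
  where
  open ℕₚ.≤-Reasoning

  line : Direction → ℕ → Line
  line d i = lineThrough d (slope2 i)

  lines : List Line
  lines = cartesianProductWith line (allFin 4) (upTo q)

  union = union? _≟ₛ_ (board-unique n) on? lines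

  length-lines : length lines ≡ 4 ℕ.* q
  length-lines = trans (length-cartesianProductWith line (allFin 4) (upTo q)) (cong (4 ℕ.*_) (length-upTo q))

  lines-unique : Unique lines
  lines-unique = Uniqueₚ.cartesianProductWith⁺ line slope2-line-injective (Uniqueₚ.allFin⁺ 4) (Uniqueₚ.upTo⁺ q)

  long : ∀ {l} → l ∈ lines → ℕ.suc (m ℕ.* 2) ≤ count (on? l) (board n)
  long l∈ with ∈-cartesianProductWith⁻ line (allFin 4) (upTo q) l∈
  ... | d , i , _ , i∈ , refl =
    line-≥ m (q ℕ.* 2) h d (proj₁ (∣slope2∣≤ (∈-upTo⁻ i∈))) (proj₂ (∣slope2∣≤ (∈-upTo⁻ i∈)))

  on-covered : ∀ {P} → Any (λ l → On l P) lines → Covered (queens q) P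
  on-covered any with find any
  ... | l , l∈ , on with ∈-cartesianProductWith⁻ line (allFin 4) (upTo q) l∈
  ... | d , i , _ , i∈ , refl = on⇒covered (queens q) d (∈-map⁺ slope2 i∈) on

-- Comparison of the two bounds and choice of the threshold

mainTheorem1 : ∀ (q : ℕ) → 0 < q → ∃ λ (N₁ : ℕ) → ∀ (n : ℕ) → N₁ ≤ n → ∀ (C : Configuration) → Optimal n q C → NonAttacking C
-- The term s makes room for the queens, p² is the Bonferroni loss, and p s is the loss from p lines
-- that each miss at most s squares. An attacking optimum would force n ≤ p² + p s.
mainTheorem1 q _ = ℕ.suc (s ℕ.+ (p ℕ.* p ℕ.+ p ℕ.* s)) , proof
  where
  p = 4 ℕ.* q
  s = 2 ℕ.+ p

  proof : ∀ n → s ℕ.+ (p ℕ.* p ℕ.+ p ℕ.* s) < n → ∀ C → Optimal n q C → NonAttacking C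
  proof n N<n C opt {Q} {Q′} Q∈C Q′∈C Q≢Q′ a = ℕₚ.<⇒≱ (ℕₚ.≤-<-trans (ℕₚ.m≤n+m _ s) N<n)
    (ℕₚ.+-cancelˡ-≤ (cover n C) n _ (begin
      cover n C ℕ.+ n
        ≤⟨ cover-attacking n C Q∈C Q′∈C Q≢Q′ a ⟩
      4 ℕ.* ∣ C ∣ ℕ.* n
        ≡⟨ cong (λ k → 4 ℕ.* k ℕ.* n) (Optimal.size opt) ⟩
      p ℕ.* n
        ≤⟨ ℕₚ.*-monoʳ-≤ p n≤ ⟩
      p ℕ.* (ℕ.suc (m ℕ.* 2) ℕ.+ s)
        ≡⟨ ℕₚ.*-distribˡ-+ p (ℕ.suc (m ℕ.* 2)) s ⟩
      p ℕ.* ℕ.suc (m ℕ.* 2) ℕ.+ p ℕ.* s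
        ≤⟨ ℕₚ.+-monoˡ-≤ (p ℕ.* s) (cover-queens q m room) ⟩
      cover n (queens q) ℕ.+ p ℕ.* p ℕ.+ p ℕ.* s
        ≤⟨ ℕₚ.+-monoˡ-≤ (p ℕ.* s) (ℕₚ.+-monoˡ-≤ (p ℕ.* p)
             (Optimal.maximal opt (queens q) (queens-size q)
               (queens-onBoard q (ℕₚ.≤-trans (ℕₚ.≤-reflexive (quadruple q)) s≤n)))) ⟩
      cover n C ℕ.+ p ℕ.* p ℕ.+ p ℕ.* s
        ≡⟨ ℕₚ.+-assoc (cover n C) _ _ ⟩
      cover n C ℕ.+ (p ℕ.* p ℕ.+ p ℕ.* s) ∎))
    where
    open ℕₚ.≤-Reasoning

    -- The largest m with 2m + s ≤ n, which is the condition of `cover-queens`; the remainder is at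
    -- most 1, so n ≤ 2m + 1 + s.
    m = (n ℕ.∸ s) ℕ./ 2

    s≤n : s ≤ n
    s≤n = ℕₚ.≤-trans (ℕₚ.m≤m+n s _) (ℕₚ.<⇒≤ N<n)

    n∸s : n ℕ.∸ s ≡ (n ℕ.∸ s) ℕ.% 2 ℕ.+ m ℕ.* 2
    n∸s = ℕDM.m≡m%n+[m/n]*n (n ℕ.∸ s) 2

    n≤ : n ≤ ℕ.suc (m ℕ.* 2) ℕ.+ s
    n≤ = begin
      n               ≡⟨ sym (ℕₚ.m∸n+n≡m s≤n) ⟩
      n ℕ.∸ s ℕ.+ s   ≡⟨ cong (ℕ._+ s) n∸s ⟩
      (n ℕ.∸ s) ℕ.% 2 ℕ.+ m ℕ.* 2 ℕ.+ s
        ≤⟨ ℕₚ.+-monoˡ-≤ s (ℕₚ.+-monoˡ-≤ (m ℕ.* 2) (ℕ.s≤s⁻¹ (ℕDM.m%n<n (n ℕ.∸ s) 2))) ⟩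
      ℕ.suc (m ℕ.* 2) ℕ.+ s ∎

    quadruple : ∀ q → 2 ℕ.+ q ℕ.* 2 ℕ.* 2 ≡ 2 ℕ.+ 4 ℕ.* q
    quadruple = ℕ-solve-∀

    rearrange : ∀ q m → 2 ℕ.+ (q ℕ.* 2 ℕ.+ m) ℕ.* 2 ≡ m ℕ.* 2 ℕ.+ (2 ℕ.+ 4 ℕ.* q)
    rearrange = ℕ-solve-∀

    room : 2 ℕ.+ (q ℕ.* 2 ℕ.+ m) ℕ.* 2 ≤ n
    room = begin
      2 ℕ.+ (q ℕ.* 2 ℕ.+ m) ℕ.* 2       ≡⟨ rearrange q m ⟩
      m ℕ.* 2 ℕ.+ s                     ≤⟨ ℕₚ.+-monoˡ-≤ s (ℕₚ.m≤n+m (m ℕ.* 2) _) ⟩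
      (n ℕ.∸ s) ℕ.% 2 ℕ.+ m ℕ.* 2 ℕ.+ s ≡⟨ cong (ℕ._+ s) (sym n∸s) ⟩
      n ℕ.∸ s ℕ.+ s                     ≡⟨ ℕₚ.m∸n+n≡m s≤n ⟩
      n                                 ∎
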